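{- Let $L$ be a non-trivial pseudocomplemented de Morgan algebra with dual $pm$-space $P$. Then $L\in\mathbf{M}_0$ if and only if, for every order component $Q$ of $P$, the subset $Q\cup\zeta(Q)$, with the induced order and $\zeta$, is isomorphic to one of $Q_0,Q_1,Q_2$.
   Context: $\mathbf{M}_0$ is the variety of regular $pm$-algebras of range $0$, i.e. pseudocomplemented de Morgan algebras $(L;\wedge,\vee,{}^\ast,{}^\prime,0,1)$ satisfying $x\wedge x^{\prime\ast\prime}\le y\vee y^\ast$ and $x\wedge x^{\prime\ast}=(x\wedge x^{\prime\ast})^{\prime\ast}$. The dual $pm$-space is the Priestley space $(P;\tau,\le)$ of prime ideals with involution $\zeta(I)=\{a:a'\notin I\}$. An order component is a maximal subset of $P$ connected in the comparability graph of $(P;\le)$. The ordered sets with involution: $Q_0$ is a single point $x$ with $\zeta(x)=x$; $Q_1$ consists of two incomparable points $x,\zeta(x)$ interchanged by $\zeta$; $Q_2$ is a two-element chain $x<\zeta(x)$ with $\zeta$ interchanging them. -}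

module Defs where

open import Level using (Level; _⊔_; suc; 0ℓ)
open import Algebra.Core using (Op₁; Op₂)
open import Algebra.Definitions using (Congruent₁; Identity; Involutive)
open import Algebra.Lattice.Bundles using (DistributiveLattice)
open import Algebra.Lattice.Structures using (IsDistributiveLattice)
import Algebra.Lattice.Properties.Lattice as LatticeProperties
open import Axiom.ExcludedMiddle using (ExcludedMiddle)
open import Data.Bool.Base using (not; f≤t; b≤b)
import Data.Bool.Properties as Bool
open import Data.Product.Base using (Σ; ∃; _×_; _,_; proj₁; proj₂)
open import Data.Sum.Base using (_⊎_; inj₁; inj₂; [_,_])
import Data.Unit.Properties as Unit
open import Function.Base using (_on_; id)
open import Function.Bundles using (_⇔_)
open import Relation.Binary.Bundles using (Poset)
open import Relation.Binary.Core using (Rel)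
open import Relation.Binary.Definitions using (_Respects_)
open import Relation.Binary.Construct.Closure.Equivalence using (EqClosure)
import Relation.Binary.Construct.On as On
open import Relation.Binary.Morphism.Structures using (IsOrderIsomorphism)
import Relation.Binary.Properties.Setoid as SetoidProperties
open import Relation.Binary.PropositionalEquality using (refl)
open import Relation.Nullary using (Dec; yes; no)
open import Relation.Nullary.Decidable using (decidable-stable)
open import Relation.Unary using (Pred; _∈_; _∉_; _⊆_; _∪_)

private
  variable
    a b c ℓ ℓ₁ ℓ₂ ℓ₃ ℓ₄ q : Level

-- The duality theory of distributive lattices is classical: the existence
-- of prime ideals needs a form of choice. Together with ExcludedMiddle,
-- the following supplies the usual set-theoretic foundation.

IsChain : (X : Poset a ℓ₁ ℓ₂) → Pred (Poset.Carrier X) q → Set (a ⊔ ℓ₂ ⊔ q)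
IsChain X C = ∀ {x y} → x ∈ C → y ∈ C → x ≤ y ⊎ y ≤ x
  where open Poset X

ZornsLemma : ∀ a ℓ₁ ℓ₂ → Set (suc (a ⊔ ℓ₁ ⊔ ℓ₂))
ZornsLemma a ℓ₁ ℓ₂ = (X : Poset a ℓ₁ ℓ₂) → let open Poset X in
  (∀ (C : Pred Carrier a) → IsChain X C → ∃ λ u → ∀ {x} → x ∈ C → x ≤ u) →
  ∃ λ m → ∀ {x} → m ≤ x → x ≈ m

record PMAlgebra c ℓ : Set (suc (c ⊔ ℓ)) where
  infixl 9 _* _′
  infixr 7 _∧_
  infixr 6 _∨_
  infix  4 _≈_
  field
    Carrier               : Set c
    _≈_                   : Rel Carrier ℓ
    _∨_                   : Op₂ Carrier
    _∧_                   : Op₂ Carrier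
    _*                    : Op₁ Carrier
    _′                    : Op₁ Carrier
    0L                    : Carrier
    1L                    : Carrier
    isDistributiveLattice : IsDistributiveLattice _≈_ _∨_ _∧_
    ∨-identity            : Identity _≈_ 0L _∨_
    ∧-identity            : Identity _≈_ 1L _∧_

  distributiveLattice : DistributiveLattice c ℓ
  distributiveLattice = record
    { isDistributiveLattice = isDistributiveLattice }

  open DistributiveLattice distributiveLattice public
    using (lattice; setoid; _≉_)

  -- x ≤ y unfolds to x ≈ x ∧ y.
  open Poset (LatticeProperties.poset lattice) public using (_≤_)

  field
    *-cong           : Congruent₁ _≈_ _*
    ′-cong           : Congruent₁ _≈_ _′
    pseudocomplement : ∀ x y → (x ∧ y ≈ 0L) ⇔ (y ≤ x *)
    ′-involutive     : Involutive _≈_ _′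
    deMorgan-∧       : ∀ x y → (x ∧ y) ′ ≈ x ′ ∨ y ′
    deMorgan-∨       : ∀ x y → (x ∨ y) ′ ≈ x ′ ∧ y ′
    0′≈1             : 0L ′ ≈ 1L
    1′≈0             : 1L ′ ≈ 0L

  open IsDistributiveLattice isDistributiveLattice public

NonTrivial : PMAlgebra c ℓ → Set ℓ
NonTrivial L = 0L ≉ 1L
  where open PMAlgebra L

-- x ′ * ′ is the dual pseudocomplement of x.
record InM₀ (L : PMAlgebra c ℓ) : Set (c ⊔ ℓ) where
  open PMAlgebra L
  field
    regular : ∀ x y → x ∧ x ′ * ′ ≤ y ∨ y *
    range₀  : ∀ x → x ∧ x ′ * ≈ (x ∧ x ′ *) ′ *

record InvolutivePoset a ℓ₁ ℓ₂ : Set (suc (a ⊔ ℓ₁ ⊔ ℓ₂)) where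
  field
    poset : Poset a ℓ₁ ℓ₂

  open Poset poset public

  field
    ζ            : Carrier → Carrier
    ζ-antitone   : ∀ {x y} → x ≤ y → ζ y ≤ ζ x
    ζ-involutive : ∀ x → ζ (ζ x) ≈ x

  ζ-cong : ∀ {x y} → x ≈ y → ζ x ≈ ζ y
  ζ-cong x≈y = antisym (ζ-antitone (reflexive (Eq.sym x≈y)))
                       (ζ-antitone (reflexive x≈y))

record _≅_ (P : InvolutivePoset a ℓ₁ ℓ₂) (R : InvolutivePoset b ℓ₃ ℓ₄)
           : Set (a ⊔ b ⊔ ℓ₁ ⊔ ℓ₂ ⊔ ℓ₃ ⊔ ℓ₄) where
  private
    module P = InvolutivePoset P
    module R = InvolutivePoset R
  field
    to                 : P.Carrier → R.Carrier
    isOrderIsomorphism : IsOrderIsomorphism P._≈_ R._≈_ P._≤_ R._≤_ to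
    ζ-homo             : ∀ x → to (P.ζ x) R.≈ R.ζ (to x)

infix 4 _≅_

Q₀ : InvolutivePoset 0ℓ 0ℓ 0ℓ
Q₀ = record
  { poset        = Unit.≡-poset
  ; ζ            = id
  ; ζ-antitone   = λ _ → refl
  ; ζ-involutive = λ _ → refl
  }

-- The order is equality, so the two points are incomparable.
Q₁ : InvolutivePoset 0ℓ 0ℓ 0ℓ
Q₁ = record
  { poset        = SetoidProperties.≈-poset Bool.≡-setoid
  ; ζ            = not
  ; ζ-antitone   = λ { refl → refl }
  ; ζ-involutive = Bool.not-involutive
  }

-- The chain false < true.
Q₂ : InvolutivePoset 0ℓ 0ℓ 0ℓ
Q₂ = record
  { poset        = Bool.≤-poset
  ; ζ            = not
  ; ζ-antitone   = λ { f≤t → f≤t ; b≤b → b≤b }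
  ; ζ-involutive = Bool.not-involutive
  }

module _ (P : InvolutivePoset a ℓ₁ ℓ₂) where
  open InvolutivePoset P

  -- EqClosure is the reflexive-transitive closure of the symmetric closure
  -- of the order; the latter is comparability. Paths stay inside Q.
  Connected : Pred Carrier q → Set (a ⊔ ℓ₂ ⊔ q)
  Connected Q = ∀ (x y : Σ Carrier Q) → EqClosure (_≤_ on proj₁) x y

  record IsOrderComponent (Q : Pred Carrier q) : Set (a ⊔ ℓ₁ ⊔ ℓ₂ ⊔ suc q) where
    field
      respects  : Q Respects _≈_
      connected : Connected Q
      maximal   : ∀ (R : Pred Carrier q) → Q ⊆ R → Connected R → R ⊆ Q

  ζ[_] : Pred Carrier q → Pred Carrier (a ⊔ ℓ₁ ⊔ q)
  ζ[ Q ] y = ∃ λ x → x ∈ Q × y ≈ ζ x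

  ∪ζ-closed : {Q : Pred Carrier q} → Q Respects _≈_ →
              ∀ {x} → x ∈ Q ∪ ζ[ Q ] → ζ x ∈ Q ∪ ζ[ Q ]
  ∪ζ-closed resp (inj₁ x∈Q)              = inj₂ (_ , x∈Q , Eq.refl)
  ∪ζ-closed resp (inj₂ (y , y∈Q , x≈ζy)) =
    inj₁ (resp (Eq.sym (Eq.trans (ζ-cong x≈ζy) (ζ-involutive y))) y∈Q)

  induced : (S : Pred Carrier q) → (∀ {x} → x ∈ S → ζ x ∈ S) →
            InvolutivePoset (a ⊔ q) ℓ₁ ℓ₂
  induced S closed = record
    { poset        = On.poset poset (proj₁ {B = S})
    ; ζ            = λ { (x , x∈S) → ζ x , closed x∈S }
    ; ζ-antitone   = ζ-antitone
    ; ζ-involutive = λ { (x , _) → ζ-involutive x }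
    }

  Q∪ζQ : (Q : Pred Carrier q) → IsOrderComponent Q →
           InvolutivePoset (a ⊔ ℓ₁ ⊔ q) ℓ₁ ℓ₂
  Q∪ζQ Q isComp = induced (Q ∪ ζ[ Q ])
    (∪ζ-closed (IsOrderComponent.respects isComp))

record PrimeIdeal (L : PMAlgebra c ℓ) : Set (suc (c ⊔ ℓ)) where
  open PMAlgebra L
  field
    ideal       : Pred Carrier (c ⊔ ℓ)
    0∈          : 0L ∈ ideal
    ∨-closed    : ∀ {x y} → x ∈ ideal → y ∈ ideal → x ∨ y ∈ ideal
    down-closed : ∀ {x y} → x ≤ y → y ∈ ideal → x ∈ ideal
    proper      : 1L ∉ ideal
    prime       : ∀ {x y} → x ∧ y ∈ ideal → x ∈ ideal ⊎ y ∈ ideal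

module _ (em : ExcludedMiddle (c ⊔ ℓ)) (L : PMAlgebra c ℓ) where
  open PMAlgebra L
  open PrimeIdeal
  private
    module ≤ = Poset (LatticeProperties.poset lattice)

    ′-antitone : ∀ {x y} → x ≤ y → y ′ ≤ x ′
    ′-antitone {x} {y} x≤y = begin
      y ′                ≈⟨ ∧-absorbs-∨ (y ′) (x ′) ⟨
      y ′ ∧ (y ′ ∨ x ′)  ≈⟨ ∧-congˡ (∨-comm (y ′) (x ′)) ⟩
      y ′ ∧ (x ′ ∨ y ′)  ≈⟨ ∧-congˡ (trans (′-cong x≤y) (deMorgan-∧ x y)) ⟨
      y ′ ∧ x ′          ∎
      where
      open import Relation.Binary.Reasoning.Setoid setoid

  ζ-ideal : PrimeIdeal L → PrimeIdeal L
  ζ-ideal I = record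
    { ideal       = λ x → x ′ ∉ ideal I
    ; 0∈          = λ 0′∈I → proper I (resp 0′≈1 0′∈I)
    ; ∨-closed    = λ {x} {y} x′∉I y′∉I x∨y′∈I →
                      [ x′∉I , y′∉I ] (prime I (resp (deMorgan-∨ x y) x∨y′∈I))
    ; down-closed = λ x≤y y′∉I x′∈I → y′∉I (down-closed I (′-antitone x≤y) x′∈I)
    ; proper      = λ 1′∉I → 1′∉I (resp (sym 1′≈0) (0∈ I))
    ; prime       = λ {x} {y} x∧y′∉I → ζ-prime x y x∧y′∉I em em
    }
    where
    resp : ∀ {x y} → x ≈ y → x ∈ ideal I → y ∈ ideal I
    resp x≈y = down-closed I (≤.reflexive (sym x≈y))

    ζ-prime : ∀ x y → (x ∧ y) ′ ∉ ideal I →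
              Dec (x ′ ∈ ideal I) → Dec (y ′ ∈ ideal I) →
              x ′ ∉ ideal I ⊎ y ′ ∉ ideal I
    ζ-prime x y h (no x′∉I)  _          = inj₁ x′∉I
    ζ-prime x y h (yes _)    (no y′∉I)  = inj₂ y′∉I
    ζ-prime x y h (yes x′∈I) (yes y′∈I) with () ← h
      (resp (sym (deMorgan-∧ x y)) (∨-closed I x′∈I y′∈I))

  -- The topology is left out: order components and isomorphism of ordered
  -- sets with involution do not depend on it.
  dualSpace : InvolutivePoset (suc (c ⊔ ℓ)) (c ⊔ ℓ) (c ⊔ ℓ)
  dualSpace = record
    { poset = record
      { Carrier        = PrimeIdeal L
      ; _≈_            = λ I J → ideal I ⊆ ideal J × ideal J ⊆ ideal I
      ; _≤_            = λ I J → ideal I ⊆ ideal J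
      ; isPartialOrder = record
        { isPreorder = record
          { isEquivalence = record
            { refl  = id , id
            ; sym   = λ (p , q) → q , p
            ; trans = λ (p , q) (r , s) → (λ x → r (p x)) , (λ x → q (s x))
            }
          ; reflexive = proj₁
          ; trans     = λ p q x → q (p x)
          }
        ; antisym = _,_
        }
      }
    ; ζ            = ζ-ideal
    ; ζ-antitone   = λ I⊆J x′∉J x′∈I → x′∉J (I⊆J x′∈I)
    ; ζ-involutive = λ I →
        (λ {x} x∈ζζI → down-closed I (≤.reflexive (sym (′-involutive x)))
                         (decidable-stable em x∈ζζI)) ,
        (λ {x} x∈I x′′∉I → x′′∉I
                         (down-closed I (≤.reflexive (′-involutive x)) x∈I))
    }

{-# OPTIONS --safe #-}

-- A prime I contains x * iff some prime below I omits x, and ζ turns this into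
-- a description of x ′ * ′. Under InM₀ this forces any two distinct comparable
-- primes to be exchanged by ζ (Paired below); conversely Paired gives both
-- identities by prime separation. Paired in turn says exactly that the
-- ζ-closure of each order component consists of a point and its image under ζ.

module Submission where

open import Defs
open import Level using (Level; _⊔_; suc; Lift; lift; lower)
import Algebra.Lattice.Properties.Lattice as LatticeProperties
open import Axiom.ExcludedMiddle using (ExcludedMiddle)
open import Data.Bool.Base as Bool using (Bool; true; false; not; f≤t; b≤b)
open import Data.Product.Base using (∃; _×_; _,_; proj₁; proj₂)
open import Data.Sum.Base using (_⊎_; inj₁; inj₂; [_,_])
open import Data.Unit.Base using (tt)
open import Function.Base using (_on_; id)
open import Function.Bundles using (_⇔_; mk⇔; Equivalence)
open import Relation.Binary.Bundles using (Poset)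
open import Relation.Binary.Core using (Rel)
open import Relation.Binary.Structures using (IsEquivalence)
open import Relation.Binary.Construct.Closure.Equivalence as EqC using (EqClosure)
open import Relation.Binary.Construct.Closure.ReflexiveTransitive using (ε; _◅_; _◅◅_)
open import Relation.Binary.Construct.Closure.Symmetric using (fwd; bwd)
import Relation.Binary.Construct.On as On
import Relation.Binary.Lattice as Order
import Relation.Binary.Lattice.Properties.JoinSemilattice as JoinProperties
import Relation.Binary.Lattice.Properties.MeetSemilattice as MeetProperties
open import Relation.Binary.Morphism.Structures using (IsOrderIsomorphism)
open import Relation.Binary.PropositionalEquality as ≡ using (_≡_; refl)
import Relation.Binary.Reasoning.Setoid as SetoidReasoning
open import Relation.Nullary using (¬_; yes; no; contradiction)
open import Relation.Nullary.Decidable using (True; toWitness; fromWitness; decidable-stable)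
open import Relation.Unary using (Pred; _∈_; _∉_; _⊆_; _∪_)
open import Relation.Unary.Relation.Binary.Subset using (⊆-poset)

private
  variable
    a f q ℓ ℓ₁ ℓ₂ : Level

-- Involutive posets

module _ (P : InvolutivePoset a ℓ₁ ℓ₂) where
  open InvolutivePoset P hiding (refl)

  -- By antisymmetry the alternative `y ≤ x` amounts to equality of `x` and `y`.
  Paired : Set _
  Paired = ∀ {x y} → x ≤ y → y ≤ x ⊎ y ≈ ζ x

  infix 4 _≃_
  -- Lying in the same orbit of `ζ`.
  _≃_ : Rel Carrier ℓ₁
  x ≃ y = x ≈ y ⊎ x ≈ ζ y

  ζ-swap : ∀ {x y} → x ≈ ζ y → ζ x ≈ y
  ζ-swap x≈ζy = Eq.trans (ζ-cong x≈ζy) (ζ-involutive _)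

  ζ-injective : ∀ {x y} → ζ x ≈ ζ y → x ≈ y
  ζ-injective ζx≈ζy = Eq.trans (Eq.sym (ζ-involutive _)) (ζ-swap ζx≈ζy)

  ≃-isEquivalence : IsEquivalence _≃_
  ≃-isEquivalence = record
    { refl  = inj₁ Eq.refl
    ; sym   = [ (λ x≈y → inj₁ (Eq.sym x≈y))
              , (λ x≈ζy → inj₂ (Eq.sym (ζ-swap x≈ζy))) ]
    ; trans = ≃-trans
    }
    where
    ≃-trans : ∀ {x y z} → x ≃ y → y ≃ z → x ≃ z
    ≃-trans (inj₁ x≈y)  (inj₁ y≈z)  = inj₁ (Eq.trans x≈y y≈z)
    ≃-trans (inj₁ x≈y)  (inj₂ y≈ζz) = inj₂ (Eq.trans x≈y y≈ζz)
    ≃-trans (inj₂ x≈ζy) (inj₁ y≈z)  = inj₂ (Eq.trans x≈ζy (ζ-cong y≈z))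
    ≃-trans (inj₂ x≈ζy) (inj₂ y≈ζz) = inj₁ (Eq.trans x≈ζy (ζ-swap y≈ζz))

  Paired⇒≤⇒≃ : Paired → ∀ {x y} → x ≤ y → x ≃ y
  Paired⇒≤⇒≃ paired x≤y with paired x≤y
  ... | inj₁ y≤x  = inj₁ (antisym x≤y y≤x)
  ... | inj₂ y≈ζx = inj₂ (Eq.sym (ζ-swap y≈ζx))

  -- Order components

  component : Carrier → Pred Carrier (a ⊔ ℓ₂)
  component x y = EqClosure _≤_ x y

  component-connected : ∀ x → Connected P (component x)
  component-connected x (y , x~y) (z , x~z) =
    lift-path x~y (EqC.symmetric _≤_ x~y ◅◅ x~z) x~z
    where
    lift-path : ∀ {y z} (x~y : component x y) → EqClosure _≤_ y z →
                (x~z : component x z) →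
                EqClosure {A = ∃ (component x)} (_≤_ on proj₁) (y , x~y) (z , x~z)
    -- The endpoints agree in the carrier but may carry different membership proofs, so a reflexive
    -- order step joins them.
    lift-path x~y ε              x~z = fwd (reflexive Eq.refl) ◅ ε
    lift-path x~y (fwd r ◅ path) x~z = fwd r ◅ lift-path (x~y ◅◅ fwd r ◅ ε) path x~z
    lift-path x~y (bwd r ◅ path) x~z = bwd r ◅ lift-path (x~y ◅◅ bwd r ◅ ε) path x~z

  component-isOrderComponent : ∀ x → IsOrderComponent P (component x)
  component-isOrderComponent x = record
    { respects  = λ y≈z x~y → x~y ◅◅ EqC.return (reflexive y≈z)
    ; connected = component-connected x
    ; maximal   = λ R Q⊆R R-connected y∈R →
        EqC.gmap proj₁ id (R-connected (x , Q⊆R ε) (_ , y∈R))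
    }

  module _ (em : ∀ {a} → ExcludedMiddle a) where

    -- The empty set is vacuously connected; maximality excludes it, since it would have to contain
    -- the component of the given point.
    orderComponent-nonempty : Carrier → {Q : Pred Carrier (a ⊔ ℓ₂)} →
                              IsOrderComponent P Q → ∃ Q
    orderComponent-nonempty x {Q} isComp with em {P = ∃ Q}
    ... | yes Q≢∅ = Q≢∅
    ... | no  Q≡∅ = x , IsOrderComponent.maximal isComp (component x)
      (λ y∈Q → contradiction (_ , y∈Q) Q≡∅) (component-connected x) ε

  -- Each comparability step stays within an orbit of `ζ`, hence so does a whole path, and applying
  -- `ζ` does not leave the orbit.
  Paired⇒∪ζ-≃ : Paired → ∀ {Q : Pred Carrier q} → Connected P Q →
                ∀ {x y} → x ∈ Q → y ∈ Q ∪ ζ[_] P Q → y ≃ x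
  Paired⇒∪ζ-≃ paired {Q} connected {x} x∈Q = λ
    { (inj₁ y∈Q)             → within y∈Q
    ; (inj₂ (z , z∈Q , y≈ζz)) → ≃.trans (inj₂ y≈ζz) (within z∈Q)
    }
    where
    module ≃ = IsEquivalence ≃-isEquivalence
    within : ∀ {y} → y ∈ Q → y ≃ x
    within y∈Q = EqC.gfold ≃-isEquivalence proj₁ (Paired⇒≤⇒≃ paired)
                           (connected (_ , y∈Q) (x , x∈Q))

-- Classification of the involutive posets with a single orbit

module TwoPoints (R : InvolutivePoset a ℓ₁ ℓ₂) (k : InvolutivePoset.Carrier R)
                 (cover : ∀ x → _≃_ R x k)
                 (k≉ζk : ¬ InvolutivePoset._≈_ R k (InvolutivePoset.ζ R k)) where
  open InvolutivePoset R hiding (refl)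

  point : Bool → Carrier
  point false = k
  point true  = ζ k

  index : Carrier → Bool
  index x = [ (λ _ → false) , (λ _ → true) ] (cover x)

  ≈point-index : ∀ x → x ≈ point (index x)
  ≈point-index x with cover x
  ... | inj₁ x≈k  = x≈k
  ... | inj₂ x≈ζk = x≈ζk

  point-injective : ∀ b b′ → point b ≈ point b′ → b ≡ b′
  point-injective false false _    = refl
  point-injective false true  k≈ζk = contradiction k≈ζk k≉ζk
  point-injective true  false ζk≈k = contradiction (Eq.sym ζk≈k) k≉ζk
  point-injective true  true  _    = refl

  -- `cover` merely chooses an alternative; since `k` and `ζ k` differ, the choice is forced.
  index-unique : ∀ {x} b → x ≈ point b → index x ≡ b
  index-unique b x≈b = point-injective _ b (Eq.trans (Eq.sym (≈point-index _)) x≈b)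

  ζ-point : ∀ b → ζ (point b) ≈ point (not b)
  ζ-point false = Eq.refl
  ζ-point true  = ζ-involutive k

  index-ζ : ∀ x → index (ζ x) ≡ not (index x)
  index-ζ x = index-unique _ (Eq.trans (ζ-cong (≈point-index x)) (ζ-point (index x)))

  module _ {_⊑_ : Rel Bool ℓ} where

    -- Shared by `Q₁` and `Q₂`, which differ only in the order `⊑` on the two representatives.
    index-isOrderIsomorphism : (∀ {b b′} → point b ≤ point b′ → b ⊑ b′) →
                               (∀ {b b′} → b ⊑ b′ → point b ≤ point b′) →
                               IsOrderIsomorphism _≈_ _≡_ _≤_ _⊑_ index
    index-isOrderIsomorphism ≤⇒⊑ ⊑⇒≤ = record
      { isOrderMonomorphism = record
        { isOrderHomomorphism = record
          { cong = λ {x} {y} x≈y → index-unique _ (Eq.trans x≈y (≈point-index y))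
          ; mono = λ {x} {y} x≤y → ≤⇒⊑
              (trans (reflexive (Eq.sym (≈point-index x)))
                     (trans x≤y (reflexive (≈point-index y))))
          }
        ; injective = λ {x} {y} ix≡iy →
            Eq.trans (≈point-index x)
              (Eq.trans (Eq.reflexive (≡.cong point ix≡iy)) (Eq.sym (≈point-index y)))
        ; cancel = λ {x} {y} ix⊑iy →
            trans (reflexive (≈point-index x))
                  (trans (⊑⇒≤ ix⊑iy) (reflexive (Eq.sym (≈point-index y))))
        }
      ; surjective = λ b → point b , index-unique b
      }

module _ (R : InvolutivePoset a ℓ₁ ℓ₂) where
  open InvolutivePoset R hiding (refl)

  fixed⇒≅Q₀ : ∀ k → (∀ x → _≃_ R x k) → k ≈ ζ k → R ≅ Q₀
  fixed⇒≅Q₀ k cover k≈ζk = record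
    { to = λ _ → tt
    ; isOrderIsomorphism = record
      { isOrderMonomorphism = record
        { isOrderHomomorphism = record { cong = λ _ → refl ; mono = λ _ → refl }
        ; injective           = λ _ → all-≈
        ; cancel              = λ _ → reflexive all-≈
        }
      ; surjective = λ _ → k , λ _ → refl
      }
    ; ζ-homo = λ _ → refl
    }
    where
    ≈k : ∀ x → x ≈ k
    ≈k x = [ id , (λ x≈ζk → Eq.trans x≈ζk (Eq.sym k≈ζk)) ] (cover x)
    all-≈ : ∀ {x y} → x ≈ y
    all-≈ = Eq.trans (≈k _) (Eq.sym (≈k _))

  incomparable⇒≅Q₁ : ∀ k → (∀ x → _≃_ R x k) → ¬ k ≤ ζ k → ¬ ζ k ≤ k → R ≅ Q₁
  incomparable⇒≅Q₁ k cover k≰ζk ζk≰k = record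
    { to                 = index
    ; isOrderIsomorphism = index-isOrderIsomorphism
        (λ {b} {b′} → discrete b b′) (λ { refl → reflexive Eq.refl })
    ; ζ-homo             = index-ζ
    }
    where
    open TwoPoints R k cover (λ k≈ζk → k≰ζk (reflexive k≈ζk))
    discrete : ∀ b b′ → point b ≤ point b′ → b ≡ b′
    discrete false false _    = refl
    discrete false true  k≤ζk = contradiction k≤ζk k≰ζk
    discrete true  false ζk≤k = contradiction ζk≤k ζk≰k
    discrete true  true  _    = refl

  below⇒≅Q₂ : ∀ k → (∀ x → _≃_ R x k) → k ≤ ζ k → ¬ k ≈ ζ k → R ≅ Q₂
  below⇒≅Q₂ k cover k≤ζk k≉ζk = record
    { to                 = index
    ; isOrderIsomorphism = index-isOrderIsomorphism
        (λ {b} {b′} → chain b b′)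
        (λ { f≤t → k≤ζk ; b≤b → reflexive Eq.refl })
    ; ζ-homo             = index-ζ
    }
    where
    open TwoPoints R k cover k≉ζk
    chain : ∀ b b′ → point b ≤ point b′ → b Bool.≤ b′
    chain false false _    = b≤b
    chain false true  _    = f≤t
    chain true  false ζk≤k = contradiction (antisym k≤ζk ζk≤k) k≉ζk
    chain true  true  _    = b≤b

  module _ (em : ∀ {a} → ExcludedMiddle a) where

    singleOrbit⇒≅Q₀⊎Q₁⊎Q₂ : ∀ k → (∀ x → _≃_ R x k) → R ≅ Q₀ ⊎ R ≅ Q₁ ⊎ R ≅ Q₂
    singleOrbit⇒≅Q₀⊎Q₁⊎Q₂ k cover
      with em {P = k ≈ ζ k} | em {P = k ≤ ζ k} | em {P = ζ k ≤ k}
    ... | yes k≈ζk | _        | _        = inj₁ (fixed⇒≅Q₀ k cover k≈ζk)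
    ... | no  k≉ζk | yes k≤ζk | _        = inj₂ (inj₂ (below⇒≅Q₂ k cover k≤ζk k≉ζk))
    ... | no  _    | no  k≰ζk | no  ζk≰k = inj₂ (inj₁ (incomparable⇒≅Q₁ k cover k≰ζk ζk≰k))
    -- The base point must be the bottom of the chain, so `ζ k` takes the place of `k`.
    ... | no  k≉ζk | no  _    | yes ζk≤k = inj₂ (inj₂ (below⇒≅Q₂ (ζ k)
      (λ x → ≃.trans (cover x) (inj₂ k≈ζζk))
      (trans ζk≤k (reflexive k≈ζζk))
      (λ ζk≈ζζk → k≉ζk (Eq.trans k≈ζζk (Eq.sym ζk≈ζζk)))))
      where
      module ≃ = IsEquivalence (≃-isEquivalence R)
      k≈ζζk : k ≈ ζ (ζ k)
      k≈ζζk = Eq.sym (ζ-involutive k)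

  -- Pairing pulls back along an isomorphism. The orders of `Q₀` and `Q₁` are equality, and the one
  -- strict step of `Q₂` joins points exchanged by `not`.
  ≅Q₀⊎Q₁⊎Q₂⇒Paired : R ≅ Q₀ ⊎ R ≅ Q₁ ⊎ R ≅ Q₂ → Paired R
  ≅Q₀⊎Q₁⊎Q₂⇒Paired (inj₁ iso) x≤y = inj₁ (cancel refl)
    where open IsOrderIsomorphism (_≅_.isOrderIsomorphism iso)
  ≅Q₀⊎Q₁⊎Q₂⇒Paired (inj₂ (inj₁ iso)) x≤y = inj₁ (cancel (≡.sym (mono x≤y)))
    where open IsOrderIsomorphism (_≅_.isOrderIsomorphism iso)
  ≅Q₀⊎Q₁⊎Q₂⇒Paired (inj₂ (inj₂ iso)) {x} x≤y =
    [ (λ ty≤tx → inj₁ (cancel ty≤tx))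
    , (λ ty≡¬tx → inj₂ (injective (≡.trans ty≡¬tx (≡.sym (_≅_.ζ-homo iso x)))))
    ] (chain (mono x≤y))
    where
    open IsOrderIsomorphism (_≅_.isOrderIsomorphism iso)
    chain : ∀ {b b′} → b Bool.≤ b′ → b′ Bool.≤ b ⊎ b′ ≡ not b
    chain f≤t = inj₂ refl
    chain b≤b = inj₁ b≤b

-- Prime ideals of pseudocomplemented de Morgan algebras

module _ {c ℓ} (L : PMAlgebra c ℓ) where
  open PMAlgebra L
  open Order.Lattice (LatticeProperties.∨-∧-orderTheoreticLattice lattice)
    using (x≤x∨y; y≤x∨y; ∨-least; x∧y≤x; x∧y≤y; ∧-greatest; antisym;
           joinSemilattice; meetSemilattice)
    renaming (refl to ≤-refl; trans to ≤-trans; reflexive to ≤-reflexive)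
  open JoinProperties joinSemilattice using (∨-monotonic)
  open MeetProperties meetSemilattice using (∧-monotonic)
  open PrimeIdeal

  0≤ : ∀ x → 0L ≤ x
  0≤ x = ≤-trans (x≤x∨y 0L x) (≤-reflexive (proj₁ ∨-identity x))

  ≤1 : ∀ x → x ≤ 1L
  ≤1 x = ≤-trans (≤-reflexive (sym (proj₂ ∧-identity x))) (x∧y≤y x 1L)

  ′-antitone : ∀ {x y} → x ≤ y → y ′ ≤ x ′
  ′-antitone {x} {y} x≤y = ≤-trans (y≤x∨y (x ′) (y ′))
    (≤-reflexive (sym (trans (′-cong x≤y) (deMorgan-∧ x y))))

  ∧-*-zero : ∀ x → x ∧ x * ≈ 0L
  ∧-*-zero x = Equivalence.from (pseudocomplement x (x *)) ≤-refl

  *-antitone : ∀ {x y} → x ≤ y → y * ≤ x *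
  *-antitone {x} {y} x≤y = Equivalence.to (pseudocomplement x (y *))
    (antisym (≤-trans (∧-monotonic x≤y ≤-refl) (≤-reflexive (∧-*-zero y))) (0≤ _))

  ∨-dual-*-one : ∀ x → x ∨ x ′ * ′ ≈ 1L
  ∨-dual-*-one x = begin
    x ∨ x ′ * ′      ≈⟨ ∨-congʳ (′-involutive x) ⟨
    x ′ ′ ∨ x ′ * ′  ≈⟨ deMorgan-∧ (x ′) (x ′ *) ⟨
    (x ′ ∧ x ′ *) ′  ≈⟨ ′-cong (∧-*-zero (x ′)) ⟩
    0L ′             ≈⟨ 0′≈1 ⟩
    1L               ∎
    where open SetoidReasoning setoid

  record IsFilter (F : Pred Carrier f) : Set (c ⊔ ℓ ⊔ f) where
    field
      1∈        : 1L ∈ F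
      ∧-closed  : ∀ {x y} → x ∈ F → y ∈ F → x ∧ y ∈ F
      up-closed : ∀ {x y} → x ≤ y → x ∈ F → y ∈ F

  module _ (I : PrimeIdeal L) where

    ideal-resp : ∀ {x y} → x ≈ y → x ∈ ideal I → y ∈ ideal I
    ideal-resp x≈y = down-closed I (≤-reflexive (sym x≈y))

    *∈-of-∉ : ∀ {x} → x ∉ ideal I → x * ∈ ideal I
    *∈-of-∉ {x} x∉I with prime I (ideal-resp (sym (∧-*-zero x)) (0∈ I))
    ... | inj₁ x∈I  = contradiction x∈I x∉I
    ... | inj₂ x*∈I = x*∈I

    ∈-of-*∉ : ∀ {x} → x * ∉ ideal I → x ∈ ideal I
    ∈-of-*∉ {x} x*∉I with prime I (ideal-resp (sym (∧-*-zero x)) (0∈ I))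
    ... | inj₁ x∈I  = x∈I
    ... | inj₂ x*∈I = contradiction x*∈I x*∉I

    ∧∉ : ∀ {x y} → x ∉ ideal I → y ∉ ideal I → x ∧ y ∉ ideal I
    ∧∉ x∉I y∉I x∧y∈I = [ x∉I , y∉I ] (prime I x∧y∈I)

    dual-*∉-of-∈ : ∀ {x} → x ∈ ideal I → x ′ * ′ ∉ ideal I
    dual-*∉-of-∈ {x} x∈I x⁺∈I =
      proper I (ideal-resp (∨-dual-*-one x) (∨-closed I x∈I x⁺∈I))

  -- From the identities to pairing

  module _ (em : ∀ {a} → ExcludedMiddle a) where

    private
      P = dualSpace em L
      module P = InvolutivePoset P

    -- Suppose `m ∈ M` and `m ′ ∈ I`. Joining `m` with an `a` in `M` outside `I` gives `x` in `M`
    -- outside `I` with `x ′ ∈ I`. Then `z` lies in `M`, regularity keeps it out of `I`, and range 0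
    -- forces it into `I`.
    strict⇒⊆ζ : InM₀ L → ∀ {I M} → I P.≤ M → ¬ M P.≤ I → M P.≤ P.ζ I
    strict⇒⊆ζ inM₀ {I} {M} I⊆M M⊈I {m} m∈M m′∈I =
      M⊈I λ {a} a∈M → decidable-stable em λ a∉I →
        let x     = m ∨ a
            z     = x ∧ x ′ *
            x∈M   = ∨-closed M m∈M a∈M
            x∉I   = λ x∈I → a∉I (down-closed I (y≤x∨y m a) x∈I)
            x′∈I  = down-closed I (′-antitone (x≤x∨y m a)) m′∈I
            x⁺∉I  = λ x⁺∈I → dual-*∉-of-∈ M x∈M (I⊆M x⁺∈I)
            -- Regularity is used with `y` equal to `x ′`, which already lies in `I`.
            x′*∉I = λ x′*∈I → ∧∉ I x∉I x⁺∉I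
                      (down-closed I (regular x (x ′)) (∨-closed I x′∈I x′*∈I))
            z∉I   = ∧∉ I x∉I x′*∉I
            z∈M   = down-closed M (x∧y≤x x (x ′ *)) x∈M
            -- Since `z ≈ z ′ *`, the dual pseudocomplement of `z` is `z ′`, so `z ∈ M` keeps `z ′`
            -- out of `M` and hence out of `I`.
            z′∉I  = λ z′∈I → dual-*∉-of-∈ M z∈M
                      (ideal-resp M (′-cong (range₀ x)) (I⊆M z′∈I))
        in z∉I (ideal-resp I (sym (range₀ x)) (*∈-of-∉ I z′∉I))
      where open InM₀ inM₀

    InM₀⇒Paired : InM₀ L → Paired P
    InM₀⇒Paired inM₀ {I} {M} I⊆M with em {P = M P.≤ I}
    ... | yes M⊆I = inj₁ M⊆I
    -- The second inclusion is the first one for ζ M ⊊ ζ I.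
    ... | no  M⊈I = inj₂
      ( strict⇒⊆ζ inM₀ {I} {M} I⊆M M⊈I
      , λ x∈ζI → proj₁ (P.ζ-involutive M)
          (strict⇒⊆ζ inM₀ {P.ζ M} {P.ζ I} (P.ζ-antitone {I} {M} I⊆M)
            (λ ζI⊆ζM → M⊈I λ x∈M → proj₁ (P.ζ-involutive I)
              (P.ζ-antitone {P.ζ I} {P.ζ M} ζI⊆ζM (proj₂ (P.ζ-involutive M) x∈M)))
            x∈ζI))

    -- Prime ideals from Zorn's lemma

    module _ (zorn : ∀ {a ℓ₁ ℓ₂} → ZornsLemma a ℓ₁ ℓ₂) where

      module _ (b : Carrier) {F : Pred Carrier f} (isFilter : IsFilter F) (b∉F : b ∉ F) where
        open IsFilter isFilter

        record AvoidingIdeal : Set (suc (c ⊔ ℓ) ⊔ f) where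
          field
            members     : Pred Carrier (c ⊔ ℓ)
            b∈          : b ∈ members
            ∨-closed    : ∀ {x y} → x ∈ members → y ∈ members → x ∨ y ∈ members
            down-closed : ∀ {x y} → x ≤ y → y ∈ members → x ∈ members
            avoids      : ∀ {x} → x ∈ F → x ∉ members

        private
          module A = AvoidingIdeal

          avoidingIdeals : Poset _ _ _
          avoidingIdeals = On.poset (⊆-poset Carrier (c ⊔ ℓ)) A.members

        ↓b : AvoidingIdeal
        ↓b = record
          { members     = λ x → Lift c (x ≤ b)
          ; b∈          = lift ≤-refl
          ; ∨-closed    = λ x≤b y≤b → lift (∨-least (lower x≤b) (lower y≤b))
          ; down-closed = λ x≤y y≤b → lift (≤-trans x≤y (lower y≤b))
          ; avoids      = λ x∈F x≤b → b∉F (up-closed (lower x≤b) x∈F)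
          }

        module _ (C : Pred AvoidingIdeal (suc (c ⊔ ℓ) ⊔ f)) (chain : IsChain avoidingIdeals C) where

          -- A chain quantifies over a large type; True em brings the union
          -- back to the universe level of ideals.
          union : Pred Carrier (c ⊔ ℓ)
          union x = Lift (c ⊔ ℓ) (True (em {P = ∃ λ I → I ∈ C × x ∈ A.members I}))

          to-union : ∀ {I x} → I ∈ C → x ∈ A.members I → x ∈ union
          to-union I∈C x∈I = lift (fromWitness (_ , I∈C , x∈I))

          from-union : ∀ {x} → x ∈ union → ∃ λ I → I ∈ C × x ∈ A.members I
          from-union x∈U = toWitness {a? = em} (lower x∈U)

          union-∨-closed : ∀ {x y} → x ∈ union → y ∈ union → x ∨ y ∈ union
          union-∨-closed x∈U y∈U with from-union x∈U | from-union y∈U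
          ... | I , I∈C , x∈I | J , J∈C , y∈J with chain I∈C J∈C
          ...   | inj₁ I⊆J = to-union J∈C (A.∨-closed J (I⊆J x∈I) y∈J)
          ...   | inj₂ J⊆I = to-union I∈C (A.∨-closed I x∈I (J⊆I y∈J))

          chain-bounded : ∃ λ U → ∀ {I} → I ∈ C → A.members I ⊆ A.members U
          chain-bounded with em {P = ∃ C}
          -- The union of the empty chain would omit `b`, so the principal ideal of `b` is the
          -- bound.
          ... | no  C≡∅       = ↓b , λ I∈C → contradiction (_ , I∈C) C≡∅
          ... | yes (J , J∈C) = record
            { members     = union
            ; b∈          = to-union J∈C (A.b∈ J)
            ; ∨-closed    = union-∨-closed
            ; down-closed = λ x≤y y∈U → let I , I∈C , y∈I = from-union y∈U in
                              to-union I∈C (A.down-closed I x≤y y∈I)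
            ; avoids      = λ x∈F x∈U → let I , _ , x∈I = from-union x∈U in
                              A.avoids I x∈F x∈I
            } , λ I∈C → to-union I∈C

        module _ (M : AvoidingIdeal)
                 (maximal : ∀ {I} → A.members M ⊆ A.members I → A.members I ⊆ A.members M) where

          -- Otherwise the ideal generated by `M` and `x` would still avoid `F`, against maximality.
          maximal-meets-F : ∀ {x} → x ∉ A.members M → ∃ λ m → m ∈ A.members M × m ∨ x ∈ F
          maximal-meets-F {x} x∉M = decidable-stable em λ disjoint →
            x∉M (maximal {M∨x disjoint}
                   (λ {m} m∈M → m , m∈M , x≤x∨y m x)
                   (b , A.b∈ M , y≤x∨y b x))
            where
            M∨x : ¬ (∃ λ m → m ∈ A.members M × m ∨ x ∈ F) → AvoidingIdeal
            M∨x disjoint = record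
              { members     = λ w → ∃ λ m → m ∈ A.members M × w ≤ m ∨ x
              ; b∈          = b , A.b∈ M , x≤x∨y b x
              ; ∨-closed    = λ (m , m∈M , v≤m∨x) (n , n∈M , w≤n∨x) →
                  m ∨ n , A.∨-closed M m∈M n∈M , ∨-least
                    (≤-trans v≤m∨x (∨-monotonic (x≤x∨y m n) ≤-refl))
                    (≤-trans w≤n∨x (∨-monotonic (y≤x∨y m n) ≤-refl))
              ; down-closed = λ v≤w (m , m∈M , w≤m∨x) → m , m∈M , ≤-trans v≤w w≤m∨x
              ; avoids      = λ w∈F (m , m∈M , w≤m∨x) →
                  disjoint (m , m∈M , up-closed w≤m∨x w∈F)
              }

          -- If both `x` and `y` were outside, some `s` in `M` would put `s ∨ x` and `s ∨ y` in `F`.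
          -- By distributivity their meet is `s ∨ (x ∧ y)`, an element of both `F` and `M`.
          maximal-prime : ∀ {x y} → x ∧ y ∈ A.members M → x ∈ A.members M ⊎ y ∈ A.members M
          maximal-prime {x} {y} x∧y∈M
            with em {P = x ∈ A.members M} | em {P = y ∈ A.members M}
          ... | yes x∈M | _       = inj₁ x∈M
          ... | no  _   | yes y∈M = inj₂ y∈M
          ... | no  x∉M | no  y∉M =
            let m , m∈M , m∨x∈F = maximal-meets-F x∉M
                n , n∈M , n∨y∈F = maximal-meets-F y∉M
                s = m ∨ n
                s∨x∈F = up-closed (∨-monotonic (x≤x∨y m n) ≤-refl) m∨x∈F
                s∨y∈F = up-closed (∨-monotonic (y≤x∨y m n) ≤-refl) n∨y∈F
            in contradiction (A.∨-closed M (A.∨-closed M m∈M n∈M) x∧y∈M)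
                 (A.avoids M (up-closed (≤-reflexive (sym (∨-distribˡ-∧ s x y)))
                                        (∧-closed s∨x∈F s∨y∈F)))

        primeIdeal-avoiding : ∃ λ (I : PrimeIdeal L) →
          b ∈ ideal I × (∀ {x} → x ∈ F → x ∉ ideal I)
        primeIdeal-avoiding with zorn avoidingIdeals chain-bounded
        ... | M , maximal = record
          { ideal       = A.members M
          ; 0∈          = A.down-closed M (0≤ b) (A.b∈ M)
          ; ∨-closed    = A.∨-closed M
          ; down-closed = A.down-closed M
          ; proper      = A.avoids M 1∈
          ; prime       = maximal-prime M (λ {I} M⊆I → proj₁ (maximal {I} M⊆I))
          } , A.b∈ M , A.avoids M

      separate : ∀ {x y} → ¬ x ≤ y → ∃ λ (I : PrimeIdeal L) → y ∈ ideal I × x ∉ ideal I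
      separate {x} {y} x≰y =
        let I , y∈I , avoids = primeIdeal-avoiding y {F = x ≤_} isFilter x≰y
        in I , y∈I , avoids ≤-refl
        where
        isFilter : IsFilter (x ≤_)
        isFilter = record
          { 1∈        = ≤1 x
          ; ∧-closed  = ∧-greatest
          ; up-closed = λ y≤z x≤y → ≤-trans x≤y y≤z
          }

      ≤-from-primes : ∀ {x y} → (∀ I → y ∈ ideal I → ¬ x ∉ ideal I) → x ≤ y
      ≤-from-primes ⊆-primes = decidable-stable em λ x≰y →
        let I , y∈I , x∉I = separate x≰y in ⊆-primes I y∈I x∉I

      -- `F` is the filter generated by `x` and the complement of `I`. It omits `0L`, because
      -- `y ∧ x ≈ 0L` gives `y ≤ x *` and so `y ∈ ideal I`. A prime avoiding `F` lies inside `I` and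
      -- omits `x`.
      *∈⇒∃⊆∌ : ∀ I {x} → x * ∈ ideal I → ∃ λ J → J P.≤ I × x ∉ ideal J
      *∈⇒∃⊆∌ I {x} x*∈I =
        let J , _ , avoids = primeIdeal-avoiding 0L isFilter 0∉F
        in J
         , (λ {y} y∈J → decidable-stable em λ y∉I → avoids (y , y∉I , x∧y≤x y x) y∈J)
         , avoids (1L , proper I , x∧y≤y 1L x)
        where
        F : Pred Carrier (c ⊔ ℓ)
        F w = ∃ λ y → y ∉ ideal I × y ∧ x ≤ w

        isFilter : IsFilter F
        isFilter = record
          { 1∈        = 1L , proper I , ≤1 _
          ; ∧-closed  = λ (y , y∉I , y∧x≤v) (z , z∉I , z∧x≤w) →
              y ∧ z , ∧∉ I y∉I z∉I , ∧-greatest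
                (≤-trans (∧-monotonic (x∧y≤x y z) ≤-refl) y∧x≤v)
                (≤-trans (∧-monotonic (x∧y≤y y z) ≤-refl) z∧x≤w)
          ; up-closed = λ v≤w (y , y∉I , y∧x≤v) → y , y∉I , ≤-trans y∧x≤v v≤w
          }

        0∉F : 0L ∉ F
        0∉F (y , y∉I , y∧x≤0) = y∉I (down-closed I
          (Equivalence.to (pseudocomplement x y)
            (trans (∧-comm x y) (antisym y∧x≤0 (0≤ _))))
          x*∈I)

      -- From pairing to the identities

      module _ (paired : Paired P) where

        -- The second hypothesis says that `x ′ *` lies in `ζ I`, so some prime `J` below `ζ I`
        -- omits `x ′`. Pairing makes `J` equal to `ζ I`, impossible as `x ∉ ideal I`, or to `I`.
        dual-*∉⇒′∉ : ∀ I {x} → x ∉ ideal I → x ′ * ′ ∉ ideal I → x ′ ∉ ideal I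
        dual-*∉⇒′∉ I {x} x∉I x⁺∉I x′∈I with *∈⇒∃⊆∌ (P.ζ I) x⁺∉I
        ... | J , J⊆ζI , x′∉J with paired {J} {P.ζ I} J⊆ζI
        ...   | inj₁ ζI⊆J  = x′∉J (ζI⊆J λ x′′∈I → x∉I (ideal-resp I (′-involutive x) x′′∈I))
        ...   | inj₂ ζI≈ζJ = x′∉J (proj₁ (ζ-injective P {I} {J} ζI≈ζJ) x′∈I)

        Paired⇒regular : ∀ x y → x ∧ x ′ * ′ ≤ y ∨ y *
        Paired⇒regular x y = ≤-from-primes λ I y∨y*∈I x∧x⁺∉I →
          let x∉I  = λ x∈I → x∧x⁺∉I (down-closed I (x∧y≤x _ _) x∈I)
              x⁺∉I = λ x⁺∈I → x∧x⁺∉I (down-closed I (x∧y≤y _ _) x⁺∈I)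
              x′∉I = dual-*∉⇒′∉ I x∉I x⁺∉I
              y∈I  = down-closed I (x≤x∨y _ _) y∨y*∈I
              K , K⊆I , y∉K = *∈⇒∃⊆∌ I (down-closed I (y≤x∨y y (y *)) y∨y*∈I)
          -- `K` is strictly below `I` because of `y`, so `I` is `ζ K`; as `x ′` is not in `K`, this
          -- puts `x` in `I`.
          in [ (λ I⊆K → y∉K (I⊆K y∈I))
             , (λ I≈ζK → x∉I (proj₂ I≈ζK λ x′∈K → x′∉I (K⊆I x′∈K)))
             ] (paired {K} {I} K⊆I)

        -- The inequality `z ≤ z ′ *` reduces to `z ′ ∧ z` being zero: a prime omitting this meet
        -- would contain `x ′` but omit `x` and `d ′`, against `dual-*∉⇒′∉`. Conversely `z ′ *` is
        -- below `x` by prime separation and below `d` by monotonicity.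
        Paired⇒range₀ : ∀ x → x ∧ x ′ * ≈ (x ∧ x ′ *) ′ *
        Paired⇒range₀ x = antisym
          (Equivalence.to (pseudocomplement (z ′) z)
            (antisym (≤-from-primes z′∧z-empty) (0≤ _)))
          (∧-greatest z′*≤x (*-antitone (′-antitone (x∧y≤x x d))))
          where
          d = x ′ *
          z = x ∧ d

          z′∧z-empty : ∀ I → 0L ∈ ideal I → ¬ z ′ ∧ z ∉ ideal I
          z′∧z-empty I _ z′∧z∉I = dual-*∉⇒′∉ I x∉I d′∉I x′∈I
            where
            x∉I : x ∉ ideal I
            x∉I x∈I = z′∧z∉I (down-closed I (≤-trans (x∧y≤y _ _) (x∧y≤x _ _)) x∈I)
            d∉I : d ∉ ideal I
            d∉I d∈I = z′∧z∉I (down-closed I (≤-trans (x∧y≤y _ _) (x∧y≤y _ _)) d∈I)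
            x′∈I : x ′ ∈ ideal I
            x′∈I = ∈-of-*∉ I d∉I
            d′∉I : d ′ ∉ ideal I
            d′∉I d′∈I = z′∧z∉I (down-closed I (x∧y≤x _ _)
              (ideal-resp I (sym (deMorgan-∧ x d)) (∨-closed I x′∈I d′∈I)))

          z′*≤x : z ′ * ≤ x
          z′*≤x = ≤-from-primes λ I x∈I z′*∉I →
            let z′∈I = ∈-of-*∉ I z′*∉I
            in dual-*∉-of-∈ I x∈I (down-closed I (′-antitone (x∧y≤y x d)) z′∈I)

        Paired⇒InM₀ : InM₀ L
        Paired⇒InM₀ = record { regular = Paired⇒regular ; range₀ = Paired⇒range₀ }

      primeIdeal-exists : NonTrivial L → PrimeIdeal L
      primeIdeal-exists 0≉1 = proj₁ (separate λ 1≤0 → 0≉1 (antisym (0≤ 1L) 1≤0))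

-- Characterisation by order components

theorem4p4 : ∀ {c ℓ} →
    (em : ∀ {a} → ExcludedMiddle a) →
    (zorn : ∀ {a ℓ₁ ℓ₂} → ZornsLemma a ℓ₁ ℓ₂) →
    (L : PMAlgebra c ℓ) → NonTrivial L →
    let P = dualSpace em L in
    InM₀ L ⇔
    ((Q : Pred (InvolutivePoset.Carrier P) (suc (c ⊔ ℓ))) (isComp : IsOrderComponent P Q) →
    (Q∪ζQ P Q isComp ≅ Q₀) ⊎ (Q∪ζQ P Q isComp ≅ Q₁) ⊎ (Q∪ζQ P Q isComp ≅ Q₂))
theorem4p4 em zorn L 0≉1 = mk⇔
  (λ inM₀ Q isComp →
    let k , k∈Q = orderComponent-nonempty P em (primeIdeal-exists L em zorn 0≉1) isComp
    in singleOrbit⇒≅Q₀⊎Q₁⊎Q₂ (Q∪ζQ P Q isComp) em (k , inj₁ k∈Q)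
         λ (_ , y∈Q∪ζQ) → Paired⇒∪ζ-≃ P (λ {I} {M} → InM₀⇒Paired L em inM₀ {I} {M})
                            (IsOrderComponent.connected isComp) k∈Q y∈Q∪ζQ)
  (λ classified → Paired⇒InM₀ L em zorn λ {I} {M} I⊆M →
    -- The component of `I` contains `M` through the one-step path `I⊆M`, so its classification
    -- settles this pair.
    let isComp = component-isOrderComponent P I
    in ≅Q₀⊎Q₁⊎Q₂⇒Paired (Q∪ζQ P (component P I) isComp) (classified _ isComp)
         {I , inj₁ ε} {M , inj₁ (EqC.return (λ {x} → I⊆M {x}))} I⊆M)
  where
  P = dualSpace em L
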